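{- For every integer $m\ge 1$, the number of $(102,000)$-avoiding inversion sequences $e$ (of any length) with $\operatorname{dist}(e)=m$ and such that the maximum value $\max(e)$ occurs exactly once in $e$ (i.e. $|\{p: e_p=\max(e)\}|=1$) equals the $3$-Fuss–Catalan number $$\frac{1}{3m+1}\binom{4m}{m}.$$
   Context: An inversion sequence of length $n$ is an integer sequence $e=(e_1,\dots,e_n)$ with $0\le e_j\le j-1$ for all $j\in\{1,\dots,n\}$. The sequence $e$ contains the pattern $102$ if there are indices $i<j<k$ with $e_j<e_i<e_k$, and contains the pattern $000$ if there are indices $i<j<k$ with $e_i=e_j=e_k$; $e$ is $(102,000)$-avoiding if it contains neither pattern. $\operatorname{dist}(e)=|\{e_i:1\le i\le n\}|$ is the number of distinct entries of $e$, and $\max(e)$ is its largest entry. -}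

module Defs where

open import Data.Nat using (ℕ; _≤_; _<_; _⊔_)
open import Data.Nat.Properties using (_≟_)
open import Data.Fin using (Fin; toℕ) renaming (_<_ to _<ᶠ_)
open import Data.List using (List; length; lookup; deduplicate; filter; foldr)
open import Data.Product using (Σ; _×_; ∃)
open import Relation.Binary.PropositionalEquality using (_≡_)
open import Relation.Nullary using (¬_)

-- A list e = (e_1,...,e_n) is an inversion sequence if 0 ≤ e_j ≤ j-1.
-- With 0-based index j (Fin n), this reads e[j] ≤ j.
IsInvSeq : List ℕ → Set
IsInvSeq e = (j : Fin (length e)) → lookup e j ≤ toℕ j

Contains102 : List ℕ → Set
Contains102 e = ∃ λ (i : Fin (length e)) → ∃ λ (j : Fin (length e)) → ∃ λ (k : Fin (length e)) →
  (i <ᶠ j) × (j <ᶠ k) × (lookup e j < lookup e i) × (lookup e i < lookup e k)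

Contains000 : List ℕ → Set
Contains000 e = ∃ λ (i : Fin (length e)) → ∃ λ (j : Fin (length e)) → ∃ λ (k : Fin (length e)) →
  (i <ᶠ j) × (j <ᶠ k) × (lookup e i ≡ lookup e j) × (lookup e j ≡ lookup e k)

dist : List ℕ → ℕ
dist e = length (deduplicate _≟_ e)

-- largest entry (entries are natural numbers; only used for nonempty e)
maxE : List ℕ → ℕ
maxE e = foldr _⊔_ 0 e

maxMult : List ℕ → ℕ
maxMult e = length (filter (_≟ maxE e) e)

Good : ℕ → List ℕ → Set
Good m e = IsInvSeq e × ¬ Contains102 e × ¬ Contains000 e × dist e ≡ m × maxMult e ≡ 1

{-# OPTIONS --safe #-}

-- Build an avoiding sequence level by level, adding all copies of the new largest value M at once.
-- Avoidance of 000 allows one or two copies, and avoidance of 102 says exactly that everything below M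
-- standing before the last copy of M is weakly increasing. So if b is one more than the largest entry of t
-- and w is the length of the longest weakly increasing prefix of t, then the first M goes to a position p
-- with b ≤ M ≤ p ≤ w and the second, if any, goes behind a further j ≤ w ∸ p entries of t. The extension has
-- slack w′ ∸ b′ equal to p ∸ M, or one more if the two copies are adjacent; hence the number of extensions
-- with a given slack depends on the slack D = w ∸ b alone. This succession rule is
--   φ ↦ ΣΣΣφ + ΣΣ(φ ∘ suc), with Σ the prefix sum,
-- and it is solved by coefficients of powers of T = 1 + x T⁴: the number of avoiding sequences with n
-- distinct values and slack D is [x^(n-D)] T^(3D+1). Adding a single copy of M to these gives
-- [x^n] T⁴ = [x^(n+1)] T.
module Submission where

open import Defs
open import Data.Nat
open import Data.Nat.Properties
open import Data.Empty using (⊥)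
open import Data.Fin using (zero; suc; toℕ) renaming (_<_ to _<ᶠ_)
open import Data.List using (List; []; _∷_; _++_; length; take; drop; filter; map; concatMap; applyUpTo; upTo; deduplicate; replicate)
  renaming (lookup to _‼_)
open import Data.List.Membership.DecPropositional _≟_ using (_∈?_)
open import Data.List.Membership.Propositional using (_∈_; _∉_; find; lose)
open import Data.List.Membership.Propositional.Properties
  using (∈-concatMap⁺; ∈-concatMap⁻; ∈-filter⁺; ∈-upTo⁺; ∈-upTo⁻; ∈-map⁺; ∈-map⁻; ∈-++⁻; deduplicate-∈⇔)
open import Data.List.Membership.Propositional.Properties.WithK using (unique∧set⇒bag)
open import Data.List.Properties using (map-++; filter-accept; filter-reject; filter-none)
open import Data.List.Relation.Binary.BagAndSetEquality using (∼bag⇒↭)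
open import Data.List.Relation.Binary.Permutation.Propositional.Properties using (↭-length)
open import Data.List.Relation.Binary.Sublist.Propositional using (_⊆_; []; _∷_; _∷ʳ_; ⊆-refl; ⊆-trans; minimum; from∈; lookup)
open import Data.List.Relation.Binary.Sublist.Propositional.Properties using (take-⊆; take⁺)
open import Data.List.Relation.Unary.All as All using ([]; _∷_)
open import Data.List.Relation.Unary.AllPairs using (AllPairs; []; _∷_)
import Data.List.Relation.Unary.AllPairs.Properties as AllPairs
open import Data.List.Relation.Unary.Any using (here; there)
open import Data.List.Relation.Unary.Unique.DecPropositional.Properties _≟_ using (deduplicate-!)
open import Data.List.Relation.Unary.Unique.Propositional using (Unique)
open import Data.List.Relation.Unary.Unique.Propositional.Properties using (upTo⁺)
open import Data.Nat.Combinatorics using (_C_; nC1≡n; nCn≡1; nCk≡nC[n∸k]; k>n⇒nCk≡0; nCk+nC[k+1]≡[n+1]C[k+1])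
open import Data.Nat.DivMod using (_/_; m*n/n≡m)
open import Data.Nat.ListAction using (sum)
open import Data.Nat.ListAction.Properties using (sum-++)
open import Data.Nat.Tactic.RingSolver using (solve-∀)
open import Data.Product using (Σ; ∃; ∃₂; _×_; _,_; proj₁; proj₂)
open import Data.Sum using (_⊎_; inj₁; inj₂)
open import Data.Unit using (⊤; tt)
open import Function using (_∘_; id; mk⇔; Equivalence)
open import Relation.Binary.PropositionalEquality
open import Relation.Nullary using (¬_; yes; no; contradiction)

-- Raney numbers and the succession rule

-- [xⁿ] Tᵏ for T = 1 + x T⁴.
raney : ℕ → ℕ → ℕ
raney zero    _       = 1
raney (suc n) zero    = 0
raney (suc n) (suc k) = raney (suc n) k + raney n (4 + k)

nC0≡1 : ∀ n → n C 0 ≡ 1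
nC0≡1 n = trans (nCk≡nC[n∸k] {0} {n} z≤n) (nCn≡1 n)

-- Absorption `(k+1) C(n,k+1) = (n-k) C(n,k)`, rearranged to avoid truncated subtraction. Pascal's
-- rule reduces `suc n` to the instances `k` and `suc k` at `n`.
C-absorb : ∀ n k → suc k * (n C suc k) + k * (n C k) ≡ n * (n C k)
C-absorb zero    zero    = refl
C-absorb zero    (suc k) = cong₂ _+_
  (trans (cong (suc (suc k) *_) (k>n⇒nCk≡0 {0} {2 + k} z<s)) (*-zeroʳ (2 + k)))
  (trans (cong (suc k *_) (k>n⇒nCk≡0 {0} {1 + k} z<s)) (*-zeroʳ (1 + k)))
C-absorb (suc n) zero
  rewrite nC1≡n (suc n) | nC0≡1 (suc n) = arith n
  where
  arith : ∀ n → 1 * suc n + 0 * 1 ≡ suc n * 1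
  arith = solve-∀
C-absorb (suc n) (suc k)
  rewrite sym (nCk+nC[k+1]≡[n+1]C[k+1] n k) | sym (nCk+nC[k+1]≡[n+1]C[k+1] n (suc k)) = begin
    (2 + k) * (c₁ + c₂) + (1 + k) * (c₀ + c₁)                            ≡⟨ regroup k c₀ c₁ c₂ ⟩
    ((2 + k) * c₂ + (1 + k) * c₁) + ((1 + k) * c₁ + k * c₀) + (c₀ + c₁)  ≡⟨ cong₂ (λ x y → x + y + (c₀ + c₁)) (C-absorb n (suc k)) (C-absorb n k) ⟩
    n * c₁ + n * c₀ + (c₀ + c₁)                                          ≡⟨ collect n c₀ c₁ ⟩
    suc n * (c₀ + c₁)                                                    ∎
  where
  open ≡-Reasoning
  c₀ c₁ c₂ : ℕ
  c₀ = n C k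
  c₁ = n C (1 + k)
  c₂ = n C (2 + k)
  regroup : ∀ k c₀ c₁ c₂ → (2 + k) * (c₁ + c₂) + (1 + k) * (c₀ + c₁) ≡
                           ((2 + k) * c₂ + (1 + k) * c₁) + ((1 + k) * c₁ + k * c₀) + (c₀ + c₁)
  regroup = solve-∀
  collect : ∀ n c₀ c₁ → n * c₁ + n * c₀ + (c₀ + c₁) ≡ suc n * (c₀ + c₁)
  collect = solve-∀

-- Raney's formula `k/(4m+k) C(4m+k,m)` at `m = n+1`, in the form `C(N,m) - 3 C(N,m-1)` with
-- `N = 4m+k-1`. In this form Pascal's rule gives both binomials the recursion of `raney`.
raney-C : ∀ n k → raney (suc n) k + 3 * ((k + (3 + 4 * n)) C n) ≡ (k + (3 + 4 * n)) C suc n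
-- Here `raney` is 0, and `C(4n+3,n+1) = 3 C(4n+3,n)` by absorption, since `(4n+3) - n = 3(n+1)`.
raney-C n zero = *-cancelˡ-≡ _ _ (suc n) (+-cancelʳ-≡ (n * c) _ _
  (trans (arith n c) (sym (C-absorb (3 + 4 * n) n))))
  where
  c : ℕ
  c = (3 + 4 * n) C n
  arith : ∀ n c → suc n * (3 * c) + n * c ≡ (3 + 4 * n) * c
  arith = solve-∀
raney-C zero (suc k) = begin
  raney 1 k + 1 + 3 * (suc (k + 3) C 0)        ≡⟨ cong (λ x → raney 1 k + 1 + 3 * x) (nC0≡1 (suc (k + 3))) ⟩
  raney 1 k + 1 + 3                            ≡⟨ +-comm (raney 1 k + 1) 3 ⟩
  3 + (raney 1 k + 1)                          ≡⟨ arith (raney 1 k) ⟩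
  1 + (raney 1 k + 3 * 1)                      ≡⟨ cong (λ x → x + (raney 1 k + 3 * x)) (nC0≡1 (k + 3)) ⟨
  (k + 3) C 0 + (raney 1 k + 3 * ((k + 3) C 0)) ≡⟨ cong ((k + 3) C 0 +_) (raney-C zero k) ⟩
  (k + 3) C 0 + (k + 3) C 1                    ≡⟨ nCk+nC[k+1]≡[n+1]C[k+1] (k + 3) 0 ⟩
  suc (k + 3) C 1                              ∎
  where
  open ≡-Reasoning
  arith : ∀ x → 3 + (x + 1) ≡ 1 + (x + 3 * 1)
  arith = solve-∀
raney-C (suc n) (suc k) = begin
  raney (2 + n) k + raney (1 + n) (4 + k) + 3 * (suc N C suc n)
    ≡⟨ cong (λ x → raney (2 + n) k + raney (1 + n) (4 + k) + 3 * x) (nCk+nC[k+1]≡[n+1]C[k+1] N n) ⟨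
  raney (2 + n) k + raney (1 + n) (4 + k) + 3 * (N C n + N C suc n)
    ≡⟨ arith (raney (2 + n) k) (raney (1 + n) (4 + k)) (N C n) (N C suc n) ⟩
  (raney (1 + n) (4 + k) + 3 * (N C n)) + (raney (2 + n) k + 3 * (N C suc n))
    ≡⟨ cong₂ _+_ (subst (λ M → raney (1 + n) (4 + k) + 3 * (M C n) ≡ M C suc n) (shift n k) (raney-C n (4 + k)))
                 (raney-C (suc n) k) ⟩
  N C suc n + N C (2 + n)
    ≡⟨ nCk+nC[k+1]≡[n+1]C[k+1] N (suc n) ⟩
  suc N C (2 + n) ∎
  where
  open ≡-Reasoning
  N : ℕ
  N = k + (3 + 4 * suc n)
  shift : ∀ n k → 4 + k + (3 + 4 * n) ≡ k + (3 + 4 * suc n)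
  shift = solve-∀
  arith : ∀ r s x y → r + s + 3 * (x + y) ≡ (s + 3 * x) + (r + 3 * y)
  arith = solve-∀

-- With `m = n+1`, `raney-C` at exponent 1 gives `r = d - 3c`, and absorption gives
-- `m d = (3m+1) c`. Eliminating `c` leaves `(3m+1) r = d`, so the division is exact.
raney-fussCatalan : ∀ n → raney (suc n) 1 ≡ ((4 * suc n) C suc n) / suc (3 * suc n)
raney-fussCatalan n = sym (trans (cong (_/ suc (3 * suc n)) (sym product)) (m*n/n≡m r (suc (3 * suc n))))
  where
  open ≡-Reasoning
  r c d : ℕ
  r = raney (suc n) 1
  c = (4 * suc n) C n
  d = (4 * suc n) C suc n
  closed : r + 3 * c ≡ d
  closed = subst (λ M → r + 3 * (M C n) ≡ M C suc n) (shift n) (raney-C n 1)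
    where
    shift : ∀ n → 1 + (3 + 4 * n) ≡ 4 * suc n
    shift = solve-∀
  absorbed : suc n * d ≡ (4 + 3 * n) * c
  absorbed = +-cancelʳ-≡ (n * c) _ _ (trans (C-absorb (4 * suc n) n) (arith n c))
    where
    arith : ∀ n c → 4 * suc n * c ≡ (4 + 3 * n) * c + n * c
    arith = solve-∀
  product : r * suc (3 * suc n) ≡ d
  product = +-cancelʳ-≡ (3 * (suc n * d)) _ _ (begin
    r * suc (3 * suc n) + 3 * (suc n * d)       ≡⟨ cong (λ x → r * suc (3 * suc n) + 3 * x) absorbed ⟩
    r * suc (3 * suc n) + 3 * ((4 + 3 * n) * c) ≡⟨ factor n r c ⟩
    suc (3 * suc n) * (r + 3 * c)               ≡⟨ cong (suc (3 * suc n) *_) closed ⟩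
    suc (3 * suc n) * d                         ≡⟨ split n d ⟩
    d + 3 * (suc n * d)                         ∎)
    where
    factor : ∀ n r c → r * suc (3 * suc n) + 3 * ((4 + 3 * n) * c) ≡ suc (3 * suc n) * (r + 3 * c)
    factor = solve-∀
    split : ∀ n d → suc (3 * suc n) * d ≡ d + 3 * (suc n * d)
    split = solve-∀

-- Prefix sums paired with powers of T

Σ≤ : (ℕ → ℕ) → ℕ → ℕ
Σ≤ f zero    = f 0
Σ≤ f (suc n) = f 0 + Σ≤ (f ∘ suc) n

Σ≤-cong : ∀ {f g} → (∀ i → f i ≡ g i) → ∀ n → Σ≤ f n ≡ Σ≤ g n
Σ≤-cong f≗g zero    = f≗g 0
Σ≤-cong f≗g (suc n) = cong₂ _+_ (f≗g 0) (Σ≤-cong (f≗g ∘ suc) n)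

Σ≤-+ : ∀ f g n → Σ≤ (λ i → f i + g i) n ≡ Σ≤ f n + Σ≤ g n
Σ≤-+ f g zero    = refl
Σ≤-+ f g (suc n) rewrite Σ≤-+ (f ∘ suc) (g ∘ suc) n = arith (f 0) (g 0) _ _
  where
  arith : ∀ a b c d → a + b + (c + d) ≡ a + c + (b + d)
  arith = solve-∀

Σ≤-const+ : ∀ c f n → Σ≤ (λ i → c + f i) n ≡ suc n * c + Σ≤ f n
Σ≤-const+ c f zero    = cong (_+ f 0) (sym (*-identityˡ c))
Σ≤-const+ c f (suc n) rewrite Σ≤-const+ c (f ∘ suc) n = arith n c (f 0) _
  where
  arith : ∀ n c x y → c + x + (suc n * c + y) ≡ suc (suc n) * c + (x + y)
  arith = solve-∀

-- `f i` occurs in the prefix sums ending at `i, ..., n`, which are `n - i + 1` in number. This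
-- turns the number of extensions of equal slack at a given first position into a third prefix sum.
Σ≤-Σ≤ : ∀ f n → Σ≤ (λ i → suc (n ∸ i) * f i) n ≡ Σ≤ (Σ≤ f) n
Σ≤-Σ≤ f zero    = *-identityˡ (f 0)
Σ≤-Σ≤ f (suc n) = begin
  suc (suc n) * f 0 + Σ≤ (λ i → suc (n ∸ i) * f (suc i)) n ≡⟨ cong (suc (suc n) * f 0 +_) (Σ≤-Σ≤ (f ∘ suc) n) ⟩
  f 0 + suc n * f 0 + Σ≤ (Σ≤ (f ∘ suc)) n                   ≡⟨ +-assoc (f 0) _ _ ⟩
  f 0 + (suc n * f 0 + Σ≤ (Σ≤ (f ∘ suc)) n)                 ≡⟨ cong (f 0 +_) (Σ≤-const+ (f 0) (Σ≤ (f ∘ suc)) n) ⟨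
  f 0 + Σ≤ (λ i → f 0 + Σ≤ (f ∘ suc) i) n                   ∎
  where open ≡-Reasoning

-- Σ_{i ≤ n} raney (n ∸ i) (k + 3 * i) * f i.
raneySum : ℕ → ℕ → (ℕ → ℕ) → ℕ
raneySum zero    k f = f 0
raneySum (suc n) k f = raney (suc n) k * f 0 + raneySum n (3 + k) (f ∘ suc)

raneySum-cong : ∀ {f g} n k → (∀ i → f i ≡ g i) → raneySum n k f ≡ raneySum n k g
raneySum-cong zero    k f≗g = f≗g 0
raneySum-cong (suc n) k f≗g = cong₂ (λ x y → raney (suc n) k * x + y) (f≗g 0) (raneySum-cong n (3 + k) (f≗g ∘ suc))

raneySum-+ : ∀ n k f g → raneySum n k (λ i → f i + g i) ≡ raneySum n k f + raneySum n k g
raneySum-+ zero    k f g = refl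
raneySum-+ (suc n) k f g rewrite raneySum-+ n (3 + k) (f ∘ suc) (g ∘ suc) = arith (raney (suc n) k) (f 0) (g 0) _ _
  where
  arith : ∀ r a b c d → r * (a + b) + (c + d) ≡ r * a + c + (r * b + d)
  arith = solve-∀

-- Iterating `T^(k+1) = T^k + x T^(k+4)` on its last term gives `T^(k+1) = T^k + x T^(k+3) + x^2
-- T^(k+6) + ...`.
raneySum-const : ∀ n k c → raneySum n k (λ _ → c) ≡ raney n (suc k) * c
raneySum-const zero    k c = sym (*-identityˡ c)
raneySum-const (suc n) k c rewrite raneySum-const n (3 + k) c = sym (*-distribʳ-+ c (raney (suc n) k) _)

raneySum-suc : ∀ n k f → raneySum (suc n) (suc k) f ≡ raneySum (suc n) k f + raneySum n (4 + k) f
raneySum-suc zero    k f = arith (raney 1 k) (f 0) (f 1)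
  where
  arith : ∀ r a b → (r + 1) * a + b ≡ r * a + b + a
  arith = solve-∀
raneySum-suc (suc n) k f rewrite raneySum-suc n (3 + k) (f ∘ suc) =
  arith (raney (2 + n) k) (raney (1 + n) (4 + k)) (f 0) _ _
  where
  arith : ∀ r s a x y → (r + s) * a + (x + y) ≡ r * a + x + (s * a + y)
  arith = solve-∀

-- After exchanging the sums, the coefficient of `f j` is a tail that `raneySum-const` evaluates to
-- `raney (n - j) (k + 3j + 1)`. Each prefix sum thus acts as one factor T.
raneySum-Σ≤ : ∀ n k f → raneySum n k (Σ≤ f) ≡ raneySum n (suc k) f
raneySum-Σ≤ zero    k f = refl
raneySum-Σ≤ (suc n) k f = begin
  r * f 0 + raneySum n (3 + k) (λ i → f 0 + Σ≤ (f ∘ suc) i)                    ≡⟨ cong (r * f 0 +_) (raneySum-+ n (3 + k) (λ _ → f 0) _) ⟩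
  r * f 0 + (raneySum n (3 + k) (λ _ → f 0) + raneySum n (3 + k) (Σ≤ (f ∘ suc))) ≡⟨ cong₂ (λ x y → r * f 0 + (x + y)) (raneySum-const n (3 + k) (f 0)) (raneySum-Σ≤ n (3 + k) (f ∘ suc)) ⟩
  r * f 0 + (raney n (4 + k) * f 0 + raneySum n (4 + k) (f ∘ suc))             ≡⟨ arith r (raney n (4 + k)) (f 0) _ ⟩
  (r + raney n (4 + k)) * f 0 + raneySum n (4 + k) (f ∘ suc)                   ∎
  where
  open ≡-Reasoning
  r : ℕ
  r = raney (suc n) k
  arith : ∀ r s a x → r * a + (s * a + x) ≡ (r + s) * a + x
  arith = solve-∀

-- The prefix sums raise the exponent to 4 and to 3; the two parts recombine by
-- `T^(3i+1) = T^(3i) + x T^(3i+4)`.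
raneySum-grow : ∀ n f →
  raneySum n 1 (λ d → Σ≤ (Σ≤ (Σ≤ f)) d + Σ≤ (Σ≤ (f ∘ suc)) d) ≡ raneySum (suc n) 1 f
raneySum-grow n f = begin
  raneySum n 1 (λ d → Σ≤ (Σ≤ (Σ≤ f)) d + Σ≤ (Σ≤ (f ∘ suc)) d)
    ≡⟨ raneySum-+ n 1 (Σ≤ (Σ≤ (Σ≤ f))) (Σ≤ (Σ≤ (f ∘ suc))) ⟩
  raneySum n 1 (Σ≤ (Σ≤ (Σ≤ f))) + raneySum n 1 (Σ≤ (Σ≤ (f ∘ suc)))
    ≡⟨ cong₂ _+_ (trans (raneySum-Σ≤ n 1 _) (trans (raneySum-Σ≤ n 2 _) (raneySum-Σ≤ n 3 f)))
                 (trans (raneySum-Σ≤ n 1 _) (raneySum-Σ≤ n 2 _)) ⟩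
  raneySum n 4 f + raneySum n 3 (f ∘ suc)
    ≡⟨ shift n ⟩
  raneySum (suc n) 1 f ∎
  where
  open ≡-Reasoning
  arith : ∀ r a x y → r * a + x + y ≡ r * a + (y + x)
  arith = solve-∀
  shift : ∀ n → raneySum n 4 f + raneySum n 3 (f ∘ suc) ≡ raneySum (suc n) 1 f
  shift zero    = cong (_+ f 1) (sym (*-identityˡ (f 0)))
  -- `raney (2 + n) 1` computes to `raney (suc n) 4`, so only the tail needs the recursion.
  shift (suc n) = trans (arith (raney (suc n) 4) (f 0) _ _)
    (cong (raney (suc n) 4 * f 0 +_) (sym (raneySum-suc n 3 (f ∘ suc))))

-- Three more factors T turn exponent 1 into 4, and `raney n 4` is `raney (suc n) 1` by computation:
-- `x T^4 = T - 1`.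
raneySum-leaf : ∀ n → raneySum n 1 (Σ≤ (Σ≤ (λ _ → 1))) ≡ raney (suc n) 1
raneySum-leaf n = trans (raneySum-Σ≤ n 1 _) (trans (raneySum-Σ≤ n 2 _)
  (trans (raneySum-const n 3 1) (*-identityʳ (raney n 4))))

-- Insertion and pattern avoidance

-- Junk: an index beyond the length appends.
ins : ℕ → ℕ → List ℕ → List ℕ
ins zero    x l       = x ∷ l
ins (suc i) x []      = x ∷ []
ins (suc i) x (y ∷ l) = y ∷ ins i x l

length-ins : ∀ i x l → length (ins i x l) ≡ suc (length l)
length-ins zero    x l       = refl
length-ins (suc i) x []      = refl
length-ins (suc i) x (y ∷ l) = cong suc (length-ins i x l)

∈-ins : ∀ i x l → x ∈ ins i x l
∈-ins zero    x l       = here refl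
∈-ins (suc i) x []      = here refl
∈-ins (suc i) x (y ∷ l) = there (∈-ins i x l)

ins-⊇ : ∀ i x l → l ⊆ ins i x l
ins-⊇ zero    x l       = x ∷ʳ ⊆-refl
ins-⊇ (suc i) x []      = x ∷ʳ []
ins-⊇ (suc i) x (y ∷ l) = refl ∷ ins-⊇ i x l

-- The prefix embedding makes weak increase applicable to what stands before `x`; the joint
-- embedding keeps the order of all remaining entries.
⊆-ins⁻ : ∀ i x l {xs} → xs ⊆ ins i x l →
  xs ⊆ l ⊎ ∃₂ λ ys zs → xs ≡ ys ++ x ∷ zs × ys ⊆ take i l × ys ++ zs ⊆ l
⊆-ins⁻ zero    x l       (_ ∷ʳ s)   = inj₁ s
⊆-ins⁻ zero    x l       (refl ∷ s) = inj₂ ([] , _ , refl , [] , s)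
⊆-ins⁻ (suc i) x []      (_ ∷ʳ s)   = inj₁ s
⊆-ins⁻ (suc i) x []      (refl ∷ s) = inj₂ ([] , _ , refl , [] , s)
⊆-ins⁻ (suc i) x (y ∷ l) (_ ∷ʳ s) with ⊆-ins⁻ i x l s
... | inj₁ s′                          = inj₁ (y ∷ʳ s′)
... | inj₂ (ys , zs , eq , pre , both) = inj₂ (ys , zs , eq , y ∷ʳ pre , y ∷ʳ both)
⊆-ins⁻ (suc i) x (y ∷ l) (refl ∷ s) with ⊆-ins⁻ i x l s
... | inj₁ s′                          = inj₁ (refl ∷ s′)
... | inj₂ (ys , zs , eq , pre , both) = inj₂ (y ∷ ys , zs , cong (y ∷_) eq , refl ∷ pre , refl ∷ both)

∈-ins⁻ : ∀ i x l {y} → y ∈ ins i x l → y ≡ x ⊎ y ∈ l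
∈-ins⁻ zero    x l       (here eq)  = inj₁ eq
∈-ins⁻ zero    x l       (there y∈) = inj₂ y∈
∈-ins⁻ (suc i) x []      (here eq)  = inj₁ eq
∈-ins⁻ (suc i) x (z ∷ l) (here eq)  = inj₂ (here eq)
∈-ins⁻ (suc i) x (z ∷ l) (there y∈) with ∈-ins⁻ i x l y∈
... | inj₁ eq = inj₁ eq
... | inj₂ y∈l = inj₂ (there y∈l)

ins-all : ∀ {P : ℕ → Set} i x l → P x → (∀ {y} → y ∈ l → P y) → ∀ {y} → y ∈ ins i x l → P y
ins-all i x l px pl y∈ with ∈-ins⁻ i x l y∈
... | inj₁ refl = px
... | inj₂ y∈l  = pl y∈l

take-ins : ∀ {i j} x l → i ≤ j → i ≤ length l → take i (ins j x l) ≡ take i l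
take-ins x l       z≤n       _         = refl
take-ins x (y ∷ l) (s≤s i≤j) (s≤s i≤l) = cong (y ∷_) (take-ins x l i≤j i≤l)

take-suc-ins : ∀ i x l → take (suc i) (ins i x l) ≡ take i l ++ x ∷ []
take-suc-ins zero    x l       = refl
take-suc-ins (suc i) x []      = refl
take-suc-ins (suc i) x (y ∷ l) = cong (y ∷_) (take-suc-ins i x l)

take-2+-ins-ins : ∀ i x l → take (2 + i) (ins i x (ins i x l)) ≡ (take i l ++ x ∷ []) ++ x ∷ []
take-2+-ins-ins zero    x l       = refl
take-2+-ins-ins (suc i) x []      = cong (x ∷_) (lemma i)
  where
  lemma : ∀ i → take (2 + i) (ins i x []) ≡ x ∷ []
  lemma zero    = refl
  lemma (suc i) = refl
take-2+-ins-ins (suc i) x (y ∷ l) = cong (y ∷_) (take-2+-ins-ins i x l)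

⊆-take-ins : ∀ i x l {xs} → xs ⊆ take i l → xs ++ x ∷ [] ⊆ ins i x l
⊆-take-ins zero    x l       []         = refl ∷ minimum l
⊆-take-ins (suc i) x []      []         = ⊆-refl
⊆-take-ins (suc i) x (y ∷ l) (_ ∷ʳ s)   = y ∷ʳ ⊆-take-ins i x l s
⊆-take-ins (suc i) x (y ∷ l) (refl ∷ s) = refl ∷ ⊆-take-ins i x l s

∈-take-ins : ∀ {i j} x l → j < i → x ∈ take i (ins j x l)
∈-take-ins {suc i} {zero}  x l       _         = here refl
∈-take-ins {suc i} {suc j} x []      _         = here refl
∈-take-ins {suc i} {suc j} x (y ∷ l) (s≤s j<i) = there (∈-take-ins x l j<i)

replicate-⊆-ins : ∀ k i x l → replicate k x ⊆ l → replicate (suc k) x ⊆ ins i x l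
replicate-⊆-ins k       zero    x l       s          = refl ∷ s
replicate-⊆-ins zero    i       x l       s          = from∈ (∈-ins i x l)
replicate-⊆-ins (suc k) (suc i) x (y ∷ l) (_ ∷ʳ s)   = y ∷ʳ replicate-⊆-ins (suc k) i x l s
replicate-⊆-ins (suc k) (suc i) x (y ∷ l) (refl ∷ s) = refl ∷ replicate-⊆-ins k i x l s

-- Taking out the first occurrence yields `x ∉ take i u`, the normal form for which `ins-injective`
-- holds.
ins-split : ∀ {x l} → x ∈ l → ∃₂ λ i u → l ≡ ins i x u × i ≤ length u × x ∉ take i u
ins-split {x} {y ∷ l} x∈ with y ≟ x
ins-split {x} {y ∷ l} x∈          | yes refl = 0 , l , refl , z≤n , λ ()
ins-split {x} {y ∷ l} (here eq)   | no y≢x = contradiction (sym eq) y≢x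
ins-split {x} {y ∷ l} (there x∈l) | no y≢x with ins-split x∈l
... | i , u , refl , i≤u , x∉ = suc i , y ∷ u , refl , s≤s i≤u , λ where
  (here eq)  → y≢x (sym eq)
  (there x∈) → x∉ x∈

-- Both `i` and `j` are the index of the first `x` in the common list.
ins-injective : ∀ {x} i j u v → i ≤ length u → j ≤ length v → x ∉ take i u → x ∉ take j v →
  ins i x u ≡ ins j x v → i ≡ j × u ≡ v
ins-injective zero    zero    u       v       _ _ _ _ refl = refl , refl
ins-injective zero    (suc j) u       (z ∷ v) _ _ _ x∉ refl = contradiction (here refl) x∉
ins-injective (suc i) zero    (y ∷ u) v       _ _ x∉ _ refl = contradiction (here refl) x∉
ins-injective {x} (suc i) (suc j) (y ∷ u) (z ∷ v) (s≤s i≤) (s≤s j≤) x∉ x∉′ eq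
  with ins-injective i j u v i≤ j≤ (x∉ ∘ there) (x∉′ ∘ there) (cong (drop 1) eq)
... | refl , refl with refl ← cong (take 1) eq = refl , refl

-- Sublists replace index triples: such conditions pass to sublists by composing embeddings, and
-- `⊆-ins⁻` analyses insertions.
WeaklyIncreasing Avoids102 Avoids000 : List ℕ → Set
WeaklyIncreasing l = ∀ {a b} → a ∷ b ∷ [] ⊆ l → a ≤ b
Avoids102 l = ∀ {a b c} → a ∷ b ∷ c ∷ [] ⊆ l → b < a → a < c → ⊥
Avoids000 l = ∀ {a} → ¬ a ∷ a ∷ a ∷ [] ⊆ l

-- `k` is the position of the head, so `Bounded 0` is the inversion-sequence condition.
Bounded : ℕ → List ℕ → Set
Bounded k []      = ⊤
Bounded k (x ∷ l) = x ≤ k × Bounded (suc k) l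

record Avoiding (l : List ℕ) : Set where
  field
    bounded : Bounded 0 l
    no102   : Avoids102 l
    no000   : Avoids000 l
open Avoiding

bounded-weaken : ∀ {j k} l → j ≤ k → Bounded j l → Bounded k l
bounded-weaken []      _   _         = tt
bounded-weaken (x ∷ l) j≤k (x≤j , r) = ≤-trans x≤j j≤k , bounded-weaken l (s≤s j≤k) r

bounded-all : ∀ {k} l → (∀ {x} → x ∈ l → x ≤ k) → Bounded k l
bounded-all []      _  = tt
bounded-all (x ∷ l) ≤k = ≤k (here refl) , bounded-all l (m≤n⇒m≤1+n ∘ ≤k ∘ there)

bounded-ins : ∀ {k} i x l → i ≤ length l → x ≤ k + i → Bounded k l → Bounded k (ins i x l)
bounded-ins {k} zero    x l       _        x≤ r         = subst (x ≤_) (+-identityʳ k) x≤ , bounded-weaken l (n≤1+n k) r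
bounded-ins {k} (suc i) x (y ∷ l) (s≤s i≤) x≤ (y≤k , r) = y≤k , bounded-ins i x l i≤ (subst (x ≤_) (+-suc k i) x≤) r

-- Deleting `x` moves the later entries one place left, which tightens their bounds. They still
-- satisfy them, being at most `x`, which is at most its own position.
bounded-ins⁻ : ∀ {k} i x l → i ≤ length l → (∀ {y} → y ∈ l → y ≤ x) → Bounded k (ins i x l) → x ≤ k + i × Bounded k l
bounded-ins⁻ {k} zero    x l       _        ≤x (x≤k , r) = subst (x ≤_) (sym (+-identityʳ k)) x≤k , bounded-all l (λ y∈ → ≤-trans (≤x y∈) x≤k)
bounded-ins⁻ {k} (suc i) x (y ∷ l) (s≤s i≤) ≤x (y≤k , r) with bounded-ins⁻ i x l i≤ (≤x ∘ there) r
... | x≤ , r′ = subst (x ≤_) (sym (+-suc k i)) x≤ , y≤k , r′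

⊆-∈ : ∀ {x : ℕ} {xs l} → x ∈ xs → xs ⊆ l → x ∈ l
⊆-∈ x∈ s = lookup s x∈

-- A new entry that is weakly largest can only be the last entry of a 102, which would need a
-- descent before it. In a 000 it would need two further copies.
avoiding-ins : ∀ {p M u} → Avoiding u → (∀ {x} → x ∈ u → x ≤ M) → M ≤ p → p ≤ length u →
  WeaklyIncreasing (take p u) → ¬ M ∷ M ∷ [] ⊆ u → Avoiding (ins p M u)
avoiding-ins {p} {M} {u} av u≤M M≤p p≤u wi noMM = record
  { bounded = bounded-ins p M u p≤u M≤p (bounded av) ; no102 = no102′ ; no000 = no000′ }
  where
  no102′ : Avoids102 (ins p M u)
  no102′ s b<a a<c with ⊆-ins⁻ p M u s
  ... | inj₁ s′ = no102 av s′ b<a a<c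
  ... | inj₂ ([] , _ , refl , _ , both) = <⇒≱ a<c (u≤M (⊆-∈ (there (here refl)) both))
  ... | inj₂ (_ ∷ [] , _ , refl , _ , both) = <⇒≱ b<a (u≤M (⊆-∈ (here refl) both))
  ... | inj₂ (_ ∷ _ ∷ [] , _ , refl , pre , _) = <⇒≱ b<a (wi pre)
  ... | inj₂ (_ ∷ _ ∷ _ ∷ [] , _ , () , _)
  ... | inj₂ (_ ∷ _ ∷ _ ∷ _ ∷ _ , _ , () , _)
  no000′ : Avoids000 (ins p M u)
  no000′ s with ⊆-ins⁻ p M u s
  ... | inj₁ s′ = no000 av s′
  ... | inj₂ ([] , _ , refl , _ , both) = noMM both
  ... | inj₂ (_ ∷ [] , _ , refl , _ , both) = noMM both
  ... | inj₂ (_ ∷ _ ∷ [] , _ , refl , _ , both) = noMM both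
  ... | inj₂ (_ ∷ _ ∷ _ ∷ [] , _ , () , _)
  ... | inj₂ (_ ∷ _ ∷ _ ∷ _ ∷ _ , _ , () , _)

-- Since `M` is absent from the prefix, the entries there are strictly below `M`, so a descent among
-- them followed by `M` would form a 102.
avoiding-ins⁻ : ∀ {p M u} → Avoiding (ins p M u) → (∀ {x} → x ∈ u → x ≤ M) → p ≤ length u → M ∉ take p u →
  Avoiding u × M ≤ p × WeaklyIncreasing (take p u)
avoiding-ins⁻ {p} {M} {u} av u≤M p≤u M∉ = record
  { bounded = proj₂ r
  ; no102   = λ s → no102 av (⊆-trans s (ins-⊇ p M u))
  ; no000   = λ s → no000 av (⊆-trans s (ins-⊇ p M u))
  } , proj₁ r , wi
  where
  r : M ≤ p × Bounded 0 u
  r = bounded-ins⁻ p M u p≤u u≤M (bounded av)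
  wi : WeaklyIncreasing (take p u)
  wi {a} s = ≮⇒≥ λ b<a → no102 av (⊆-take-ins p M u s) b<a
    (≤∧≢⇒< (u≤M (⊆-∈ (⊆-∈ (here refl) s) (take-⊆ p u))) λ { refl → M∉ (⊆-∈ (here refl) s) })

twice-ins⇒∈ : ∀ {i x l} → x ∷ x ∷ [] ⊆ ins i x l → x ∈ l
twice-ins⇒∈ {i} {x} {l} s with ⊆-ins⁻ i x l s
... | inj₁ s′ = ⊆-∈ (here refl) s′
... | inj₂ ([] , _ , refl , _ , both) = ⊆-∈ (here refl) both
... | inj₂ (_ ∷ [] , _ , refl , _ , both) = ⊆-∈ (here refl) both
... | inj₂ (_ ∷ _ ∷ [] , _ , () , _)
... | inj₂ (_ ∷ _ ∷ _ ∷ _ , _ , () , _)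

⊆-snoc⁻ : ∀ {M} l {xs} → xs ⊆ l ++ M ∷ [] → xs ⊆ l ⊎ ∃ λ (ys : List ℕ) → xs ≡ ys ++ M ∷ [] × ys ⊆ l
⊆-snoc⁻ []      (_ ∷ʳ s)    = inj₁ s
⊆-snoc⁻ []      (refl ∷ []) = inj₂ ([] , refl , [])
⊆-snoc⁻ (y ∷ l) (_ ∷ʳ s) with ⊆-snoc⁻ l s
... | inj₁ s′             = inj₁ (y ∷ʳ s′)
... | inj₂ (ys , eq , s′) = inj₂ (ys , eq , y ∷ʳ s′)
⊆-snoc⁻ (y ∷ l) (refl ∷ s) with ⊆-snoc⁻ l s
... | inj₁ s′             = inj₁ (refl ∷ s′)
... | inj₂ (ys , eq , s′) = inj₂ (y ∷ ys , cong (y ∷_) eq , refl ∷ s′)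

weaklyIncreasing-snoc : ∀ {M} l → (∀ {x} → x ∈ l → x ≤ M) → WeaklyIncreasing l → WeaklyIncreasing (l ++ M ∷ [])
weaklyIncreasing-snoc l ≤M wi s with ⊆-snoc⁻ l s
... | inj₁ s′ = wi s′
... | inj₂ ([] , () , _)
... | inj₂ (_ ∷ [] , refl , s′) = ≤M (⊆-∈ (here refl) s′)
... | inj₂ (_ ∷ _ ∷ [] , () , _)
... | inj₂ (_ ∷ _ ∷ _ ∷ _ , () , _)

-- For maximality of prefixes: one that reaches beyond the new `M` contains the entry right behind
-- it. Membership in `take (suc p) u` later shows that this entry is not a second copy of `M`.
follower : ∀ {i} p M u → 2 + p ≤ i → i ≤ suc (length u) → p ≤ length u →
  ∃ λ y → M ∷ y ∷ [] ⊆ take i (ins p M u) × y ∈ take (suc p) u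
follower zero    M (y ∷ u) (s≤s (s≤s _)) _        _        = y , refl ∷ refl ∷ minimum _ , here refl
follower zero    M []      (s≤s (s≤s _)) (s≤s ()) _
follower (suc p) M (z ∷ u) (s≤s 2+p≤i)   (s≤s i≤) (s≤s p≤) with follower p M u 2+p≤i i≤ p≤
... | y , s , y∈ = y , z ∷ʳ s , there y∈

follower₂ : ∀ {i} p M u → 3 + p ≤ i → i ≤ 2 + length u → p ≤ length u →
  ∃ λ y → M ∷ y ∷ [] ⊆ take i (ins p M (ins p M u)) × y ∈ u
follower₂ zero    M (y ∷ u) (s≤s (s≤s (s≤s _))) _              _        = y , refl ∷ M ∷ʳ refl ∷ minimum _ , here refl
follower₂ zero    M []      (s≤s (s≤s (s≤s _))) (s≤s (s≤s ())) _
follower₂ (suc p) M (z ∷ u) (s≤s 3+p≤i)         (s≤s i≤)       (s≤s p≤) with follower₂ p M u 3+p≤i i≤ p≤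
... | y , s , y∈ = y , z ∷ʳ s , there y∈

-- Distinct values and multiplicity of the maximum

-- Duplicate-free lists with the same elements are permutations of each other; thus `deduplicate`
-- need not be traced through an insertion.
dist-unique : ∀ {xs l} → Unique xs → (∀ {x} → x ∈ xs → x ∈ l) → (∀ {x} → x ∈ l → x ∈ xs) → dist l ≡ length xs
dist-unique {xs} {l} uniq to from = ↭-length (∼bag⇒↭ (unique∧set⇒bag (deduplicate-! l) uniq
  (mk⇔ (from ∘ Equivalence.from (deduplicate-∈⇔ _≟_)) (Equivalence.to (deduplicate-∈⇔ _≟_) ∘ to))))

dist-ins-∉ : ∀ {i M u} → M ∉ u → dist (ins i M u) ≡ suc (dist u)
dist-ins-∉ {i} {M} {u} M∉u = dist-unique {M ∷ deduplicate _≟_ u}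
  (All.tabulate (λ { y∈ refl → M∉u (Equivalence.from (deduplicate-∈⇔ _≟_) y∈) }) ∷ deduplicate-! u)
  (λ { (here refl) → ∈-ins i M u
     ; (there x∈)  → ⊆-∈ (Equivalence.from (deduplicate-∈⇔ _≟_) x∈) (ins-⊇ i M u) })
  (ins-all i M u (here refl) (there ∘ Equivalence.to (deduplicate-∈⇔ _≟_)))

dist-ins-∈ : ∀ {i M u} → M ∈ u → dist (ins i M u) ≡ dist u
dist-ins-∈ {i} {M} {u} M∈u = dist-unique (deduplicate-! u)
  (λ x∈ → ⊆-∈ (Equivalence.from (deduplicate-∈⇔ _≟_) x∈) (ins-⊇ i M u))
  (Equivalence.to (deduplicate-∈⇔ _≟_) ∘ ins-all i M u M∈u (λ x∈ → x∈))

≤-maxE : ∀ {x} l → x ∈ l → x ≤ maxE l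
≤-maxE (y ∷ l) (here refl) = m≤m⊔n y (maxE l)
≤-maxE (y ∷ l) (there x∈)  = ≤-trans (≤-maxE l x∈) (m≤n⊔m y (maxE l))

maxE-∈ : ∀ x l → maxE (x ∷ l) ∈ x ∷ l
maxE-∈ x []      = here (⊔-identityʳ x)
maxE-∈ x (y ∷ l) with ⊔-sel x (maxE (y ∷ l))
... | inj₁ eq = here eq
... | inj₂ eq = there (subst (_∈ y ∷ l) (sym eq) (maxE-∈ y l))

maxE-ins : ∀ {M} p u → (∀ {x} → x ∈ u → x ≤ M) → maxE (ins p M u) ≡ M
maxE-ins {M} p u u≤M = ≤-antisym (upper (ins p M u) (ins-all p M u ≤-refl u≤M)) (≤-maxE (ins p M u) (∈-ins p M u))
  where
  upper : ∀ l → (∀ {x} → x ∈ l → x ≤ M) → maxE l ≤ M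
  upper []      _  = z≤n
  upper (x ∷ l) ≤M = ⊔-lub (≤M (here refl)) (upper l (≤M ∘ there))

count-ins : ∀ i M u → length (filter (_≟ M) (ins i M u)) ≡ suc (length (filter (_≟ M) u))
count-ins zero    M u  = cong length (filter-accept (_≟ M) refl)
count-ins (suc i) M [] = cong length (filter-accept (_≟ M) refl)
count-ins (suc i) M (y ∷ u) with y ≟ M
... | yes y≡M = begin
  length (filter (_≟ M) (y ∷ ins i M u)) ≡⟨ cong length (filter-accept (_≟ M) y≡M) ⟩
  suc (length (filter (_≟ M) (ins i M u))) ≡⟨ cong suc (count-ins i M u) ⟩
  2 + length (filter (_≟ M) u)           ≡⟨ cong (suc ∘ length) (filter-accept (_≟ M) y≡M) ⟨
  suc (length (filter (_≟ M) (y ∷ u)))   ∎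
  where open ≡-Reasoning
... | no  y≢M = begin
  length (filter (_≟ M) (y ∷ ins i M u)) ≡⟨ cong length (filter-reject (_≟ M) y≢M) ⟩
  length (filter (_≟ M) (ins i M u))     ≡⟨ count-ins i M u ⟩
  suc (length (filter (_≟ M) u))         ≡⟨ cong (suc ∘ length) (filter-reject (_≟ M) y≢M) ⟨
  suc (length (filter (_≟ M) (y ∷ u)))   ∎
  where open ≡-Reasoning

maxMult-ins : ∀ {M} p u → (∀ {x} → x ∈ u → x ≤ M) → maxMult (ins p M u) ≡ suc (length (filter (_≟ M) u))
maxMult-ins {M} p u u≤M = trans (cong (λ m → length (filter (_≟ m) (ins p M u))) (maxE-ins p u u≤M)) (count-ins p M u)

∉⇒count≡0 : ∀ {M u} → M ∉ u → length (filter (_≟ M) u) ≡ 0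
∉⇒count≡0 {M} M∉u = cong length (filter-none (_≟ M) (All.tabulate λ { x∈ refl → M∉u x∈ }))

count≡0⇒∉ : ∀ {M} u → length (filter (_≟ M) u) ≡ 0 → M ∉ u
count≡0⇒∉ {M} u eq M∈u with filter (_≟ M) u | ∈-filter⁺ (_≟ M) M∈u refl
count≡0⇒∉ u () M∈u | _ ∷ _ | _

-- Translation between indices and sublists

invSeq⇒bounded : ∀ {k} e → (∀ j → e ‼ j ≤ k + toℕ j) → Bounded k e
invSeq⇒bounded     []      _ = tt
invSeq⇒bounded {k} (x ∷ e) h = subst (x ≤_) (+-identityʳ k) (h zero) ,
  invSeq⇒bounded e (λ j → subst ((e ‼ j) ≤_) (+-suc k (toℕ j)) (h (suc j)))

bounded⇒invSeq : ∀ {k} e → Bounded k e → ∀ j → e ‼ j ≤ k + toℕ j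
bounded⇒invSeq {k} (x ∷ e) (x≤k , r) zero    = subst (x ≤_) (sym (+-identityʳ k)) x≤k
bounded⇒invSeq {k} (x ∷ e) (x≤k , r) (suc j) = subst ((e ‼ j) ≤_) (sym (+-suc k (toℕ j))) (bounded⇒invSeq e r j)

lookup₁-⊆ : ∀ (e : List ℕ) j → (e ‼ j) ∷ [] ⊆ e
lookup₁-⊆ (x ∷ e) zero    = refl ∷ minimum e
lookup₁-⊆ (x ∷ e) (suc j) = x ∷ʳ lookup₁-⊆ e j

lookup₂-⊆ : ∀ (e : List ℕ) {i j} → i <ᶠ j → (e ‼ i) ∷ (e ‼ j) ∷ [] ⊆ e
lookup₂-⊆ (x ∷ e) {zero}  {suc j} _         = refl ∷ lookup₁-⊆ e j
lookup₂-⊆ (x ∷ e) {suc i} {suc j} (s≤s i<j) = x ∷ʳ lookup₂-⊆ e i<j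

lookup₃-⊆ : ∀ (e : List ℕ) {i j k} → i <ᶠ j → j <ᶠ k → (e ‼ i) ∷ (e ‼ j) ∷ (e ‼ k) ∷ [] ⊆ e
lookup₃-⊆ (x ∷ e) {zero}  {suc j} {suc k} _         (s≤s j<k) = refl ∷ lookup₂-⊆ e j<k
lookup₃-⊆ (x ∷ e) {suc i} {suc j} {suc k} (s≤s i<j) (s≤s j<k) = x ∷ʳ lookup₃-⊆ e i<j j<k

⊆-lookup₁ : ∀ (e : List ℕ) {a} → a ∷ [] ⊆ e → ∃ λ i → e ‼ i ≡ a
⊆-lookup₁ (x ∷ e) (_ ∷ʳ s) with ⊆-lookup₁ e s
... | i , eq = suc i , eq
⊆-lookup₁ (x ∷ e) (refl ∷ s) = zero , refl

⊆-lookup₂ : ∀ (e : List ℕ) {a b} → a ∷ b ∷ [] ⊆ e → ∃₂ λ i j → i <ᶠ j × e ‼ i ≡ a × e ‼ j ≡ b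
⊆-lookup₂ (x ∷ e) (_ ∷ʳ s) with ⊆-lookup₂ e s
... | i , j , i<j , eqs = suc i , suc j , s≤s i<j , eqs
⊆-lookup₂ (x ∷ e) (refl ∷ s) with ⊆-lookup₁ e s
... | j , eq = zero , suc j , z<s , refl , eq

⊆-lookup₃ : ∀ (e : List ℕ) {a b c} → a ∷ b ∷ c ∷ [] ⊆ e →
  ∃ λ i → ∃₂ λ j k → i <ᶠ j × j <ᶠ k × e ‼ i ≡ a × e ‼ j ≡ b × e ‼ k ≡ c
⊆-lookup₃ (x ∷ e) (_ ∷ʳ s) with ⊆-lookup₃ e s
... | i , j , k , i<j , j<k , eqs = suc i , suc j , suc k , s≤s i<j , s≤s j<k , eqs
⊆-lookup₃ (x ∷ e) (refl ∷ s) with ⊆-lookup₂ e s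
... | j , k , j<k , eqs = zero , suc j , suc k , z<s , s≤s j<k , refl , eqs

good⇒avoiding : ∀ {m e} → Good m e → Avoiding e
good⇒avoiding {m} {e} (inv , n102 , n000 , _) = record
  { bounded = invSeq⇒bounded e inv
  ; no102   = no102′
  ; no000   = no000′ }
  where
  no102′ : Avoids102 e
  no102′ s b<a a<c with ⊆-lookup₃ e s
  ... | i , j , k , i<j , j<k , refl , refl , refl = n102 (i , j , k , i<j , j<k , b<a , a<c)
  no000′ : Avoids000 e
  no000′ s with ⊆-lookup₃ e s
  ... | i , j , k , i<j , j<k , p , q , r = n000 (i , j , k , i<j , j<k , trans p (sym q) , trans q (sym r))

avoiding⇒good : ∀ {e} → Avoiding e → maxMult e ≡ 1 → Good (dist e) e
avoiding⇒good {e} av mult = bounded⇒invSeq e (bounded av)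
  , (λ (i , j , k , i<j , j<k , b<a , a<c) → no102 av (lookup₃-⊆ e i<j j<k) b<a a<c)
  , (λ (i , j , k , i<j , j<k , p , q) → no000 av
      (subst₂ (λ y z → y ∷ (e ‼ j) ∷ z ∷ [] ⊆ e) p (sym q) (lookup₃-⊆ e i<j j<k)))
  , refl , mult

-- The generating tree

Distinct : {A K : Set} → (A → K) → List A → Set
Distinct key = AllPairs λ x y → key x ≢ key y

-- A key shared by two blocks would force equal keys of the elements they stem from, against
-- distinctness of `xs`.
concatMap-distinct : {A B K L : Set} (key : A → K) (key′ : B → L) {f : A → List B} {xs : List A} →
  Distinct key xs → (∀ {x} → x ∈ xs → Distinct key′ (f x)) →
  (∀ {x y z w} → x ∈ xs → y ∈ xs → z ∈ f x → w ∈ f y → key′ z ≡ key′ w → key x ≡ key y) →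
  Distinct key′ (concatMap f xs)
concatMap-distinct key key′ [] _ _ = []
concatMap-distinct key key′ {f} {x ∷ xs} (x≢ ∷ xs!) inner separated = AllPairs.++⁺ (inner (here refl))
  (concatMap-distinct key key′ xs! (inner ∘ there) λ x∈ y∈ → separated (there x∈) (there y∈))
  (All.tabulate λ z∈ → All.tabulate λ w∈ eq →
    let y , y∈ , w∈fy = find (∈-concatMap⁻ f w∈)
    in All.lookup x≢ y∈ (separated (here refl) (there y∈) z∈ w∈fy eq))

Σ≤-* : ∀ c f n → Σ≤ (λ i → c * f i) n ≡ c * Σ≤ f n
Σ≤-* c f zero    = refl
Σ≤-* c f (suc n) rewrite Σ≤-* c (f ∘ suc) n = sym (*-distribˡ-+ c (f 0) _)

sum-map-concatMap : {A B : Set} (φ : B → ℕ) (f : A → List B) (xs : List A) →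
  sum (map φ (concatMap f xs)) ≡ sum (map (λ x → sum (map φ (f x))) xs)
sum-map-concatMap φ f []       = refl
sum-map-concatMap φ f (x ∷ xs) = begin
  sum (map φ (f x ++ concatMap f xs))                       ≡⟨ cong sum (map-++ φ (f x) (concatMap f xs)) ⟩
  sum (map φ (f x) ++ map φ (concatMap f xs))               ≡⟨ sum-++ (map φ (f x)) _ ⟩
  sum (map φ (f x)) + sum (map φ (concatMap f xs))          ≡⟨ cong (sum (map φ (f x)) +_) (sum-map-concatMap φ f xs) ⟩
  sum (map φ (f x)) + sum (map (λ x → sum (map φ (f x))) xs) ∎
  where open ≡-Reasoning

sum-applyUpTo : ∀ (f g : ℕ → ℕ) n → sum (map f (applyUpTo g (suc n))) ≡ Σ≤ (f ∘ g) n
sum-applyUpTo f g zero    = +-identityʳ (f (g 0))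
sum-applyUpTo f g (suc n) = cong (f (g 0) +_) (sum-applyUpTo f (g ∘ suc) n)

sum-map-cong : {A : Set} {f g : A → ℕ} → (∀ x → f x ≡ g x) → ∀ xs → sum (map f xs) ≡ sum (map g xs)
sum-map-cong f≗g []       = refl
sum-map-cong f≗g (x ∷ xs) = cong₂ _+_ (f≗g x) (sum-map-cong f≗g xs)

-- The pairs `c ≤ a ≤ D` parametrise the placements `b ≤ M ≤ p ≤ b + D` of the first copy.
triangle : {A : Set} → (ℕ → ℕ → List A) → ℕ → List A
triangle g D = concatMap (λ a → concatMap (g a) (upTo (suc a))) (upTo (suc D))

module _ {A : Set} {g : ℕ → ℕ → List A} where

  ∈-triangle⁺ : ∀ {D a c z} → a ≤ D → c ≤ a → z ∈ g a c → z ∈ triangle g D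
  ∈-triangle⁺ a≤D c≤a z∈ = ∈-concatMap⁺ _ (lose (∈-upTo⁺ (s≤s a≤D)) (∈-concatMap⁺ _ (lose (∈-upTo⁺ (s≤s c≤a)) z∈)))

  ∈-triangle⁻ : ∀ {D z} → z ∈ triangle g D → ∃₂ λ a c → a ≤ D × c ≤ a × z ∈ g a c
  ∈-triangle⁻ {D} z∈ with find (∈-concatMap⁻ _ {xs = upTo (suc D)} z∈)
  ... | a , a∈ , z∈′ with find (∈-concatMap⁻ _ {xs = upTo (suc a)} z∈′)
  ... | c , c∈ , z∈″ = a , c , ≤-pred (∈-upTo⁻ a∈) , ≤-pred (∈-upTo⁻ c∈) , z∈″

  triangle-distinct : {K : Set} (key : A → K) (D : ℕ) →
    (∀ {a c} → a ≤ D → c ≤ a → Distinct key (g a c)) →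
    (∀ {a c a′ c′ z w} → a ≤ D → c ≤ a → a′ ≤ D → c′ ≤ a′ → z ∈ g a c → w ∈ g a′ c′ → key z ≡ key w → a ≡ a′ × c ≡ c′) →
    Distinct key (triangle g D)
  triangle-distinct key D inner separated = concatMap-distinct id key (upTo⁺ (suc D))
    (λ {a} a∈ → concatMap-distinct id key (upTo⁺ (suc a))
      (λ c∈ → inner (≤-pred (∈-upTo⁻ a∈)) (≤-pred (∈-upTo⁻ c∈)))
      λ c∈ c′∈ z∈ w∈ eq → proj₂ (separated (≤-pred (∈-upTo⁻ a∈)) (≤-pred (∈-upTo⁻ c∈)) (≤-pred (∈-upTo⁻ a∈)) (≤-pred (∈-upTo⁻ c′∈)) z∈ w∈ eq))
    λ {a} {a′} a∈ a′∈ z∈ w∈ eq →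
      let c  , c∈  , z∈′ = find (∈-concatMap⁻ (g a) {xs = upTo (suc a)} z∈)
          c′ , c′∈ , w∈′ = find (∈-concatMap⁻ (g a′) {xs = upTo (suc a′)} w∈)
      in proj₁ (separated (≤-pred (∈-upTo⁻ a∈)) (≤-pred (∈-upTo⁻ c∈)) (≤-pred (∈-upTo⁻ a′∈)) (≤-pred (∈-upTo⁻ c′∈)) z∈′ w∈′ eq)

  sum-triangle : ∀ (φ : A → ℕ) D →
    sum (map φ (triangle g D)) ≡ Σ≤ (λ a → Σ≤ (λ c → sum (map φ (g a c))) a) D
  sum-triangle φ D = trans (sum-map-concatMap φ (λ a → concatMap (g a) (upTo (suc a))) (upTo (suc D))) (trans (sum-applyUpTo _ id D)
    (Σ≤-cong (λ a → trans (sum-map-concatMap φ (g a) (upTo (suc a))) (sum-applyUpTo _ id a)) D))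

record Node : Set where
  constructor node
  field
    seq   : List ℕ
    bound : ℕ
    slack : ℕ
open Node

-- bound is one more than the largest entry (0 for the empty list), and bound + slack is the length of the
-- longest weakly increasing prefix.
record Canonical (n : ℕ) (s : Node) : Set where
  field
    avoiding   : Avoiding (seq s)
    dist≡      : dist (seq s) ≡ n
    below      : ∀ {x} → x ∈ seq s → x < bound s
    least      : ∀ {M} → (∀ {x} → x ∈ seq s → x < M) → bound s ≤ M
    room       : bound s + slack s ≤ length (seq s)
    increasing : WeaklyIncreasing (take (bound s + slack s) (seq s))
    maximal    : ∀ {i} → i ≤ length (seq s) → WeaklyIncreasing (take i (seq s)) → i ≤ bound s + slack s
open Canonical

-- The first argument is the number of entries between the two copies. If it is 0, the weakly
-- increasing prefix contains both copies and is one longer.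
nextSlack : ℕ → ℕ → ℕ
nextSlack zero    c = suc c
nextSlack (suc _) c = c

-- Parametrised by a = p ∸ b and c = p ∸ M.
childrenAt : Node → ℕ → ℕ → List Node
childrenAt (node t b D) a c =
  node (ins p M t) (suc M) c ∷
  map (λ j → node (ins p M (ins (p + j) M t)) (suc M) (nextSlack j c)) (upTo (suc (D ∸ a)))
  where
  p M : ℕ
  p = b + a
  M = b + (a ∸ c)

children : Node → List Node
children s = triangle (childrenAt s) (slack s)

topsAt : Node → ℕ → ℕ → List (List ℕ)
topsAt (node t b D) a c = ins (b + a) (b + (a ∸ c)) t ∷ []

tops : Node → List (List ℕ)
tops s = triangle (topsAt s) (slack s)

nodes : ℕ → List Node
nodes zero    = node [] 0 0 ∷ []
nodes (suc n) = concatMap children (nodes n)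

-- Slack `c` arises from the single copy and from the `slack s ∸ a` non-adjacent pairs, slack
-- `suc c` from the adjacent pair.
sum-childrenAt : ∀ (φ : ℕ → ℕ) s a c →
  sum (map (φ ∘ slack) (childrenAt s a c)) ≡ suc (slack s ∸ a) * φ c + φ (suc c)
sum-childrenAt φ s a c = begin
  -- The offset function is `suc` because the adjacent pair `j = 0` has been split off.
  φ c + (φ (suc c) + _)                 ≡⟨ cong (λ x → φ c + (φ (suc c) + x)) (rest _ suc (slack s ∸ a) (λ _ → refl)) ⟩
  φ c + (φ (suc c) + (slack s ∸ a) * φ c) ≡⟨ arith (φ c) (φ (suc c)) _ ⟩
  suc (slack s ∸ a) * φ c + φ (suc c)   ∎
  where
  open ≡-Reasoning
  rest : ∀ (mk : ℕ → Node) g n → (∀ j → slack (mk (g j)) ≡ c) →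
    sum (map (φ ∘ slack) (map mk (applyUpTo g n))) ≡ n * φ c
  rest mk g zero    eq = refl
  rest mk g (suc n) eq = cong₂ _+_ (cong φ (eq 0)) (rest mk (g ∘ suc) n (eq ∘ suc))
  arith : ∀ x y z → x + (y + z) ≡ x + z + y
  arith = solve-∀

sum-children : ∀ (φ : ℕ → ℕ) s → sum (map (φ ∘ slack) (children s)) ≡
  Σ≤ (Σ≤ (Σ≤ φ)) (slack s) + Σ≤ (Σ≤ (φ ∘ suc)) (slack s)
sum-children φ s = begin
  sum (map (φ ∘ slack) (children s))
    ≡⟨ sum-triangle {g = childrenAt s} (φ ∘ slack) D ⟩
  Σ≤ (λ a → Σ≤ (λ c → sum (map (φ ∘ slack) (childrenAt s a c))) a) D
    ≡⟨ Σ≤-cong (λ a → Σ≤-cong (sum-childrenAt φ s a) a) D ⟩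
  Σ≤ (λ a → Σ≤ (λ c → suc (D ∸ a) * φ c + φ (suc c)) a) D
    ≡⟨ Σ≤-cong (λ a → trans (Σ≤-+ _ (φ ∘ suc) a) (cong (_+ Σ≤ (φ ∘ suc) a) (Σ≤-* (suc (D ∸ a)) φ a))) D ⟩
  Σ≤ (λ a → suc (D ∸ a) * Σ≤ φ a + Σ≤ (φ ∘ suc) a) D
    ≡⟨ Σ≤-+ _ _ D ⟩
  Σ≤ (λ a → suc (D ∸ a) * Σ≤ φ a) D + Σ≤ (Σ≤ (φ ∘ suc)) D
    ≡⟨ cong (_+ Σ≤ (Σ≤ (φ ∘ suc)) D) (Σ≤-Σ≤ (Σ≤ φ) D) ⟩
  Σ≤ (Σ≤ (Σ≤ φ)) D + Σ≤ (Σ≤ (φ ∘ suc)) D ∎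
  where
  open ≡-Reasoning
  D : ℕ
  D = slack s

-- An arbitrary weight is required because the induction replaces `φ` by `grown`. The indicator of a
-- slack D would give the count `raney (n - D) (3D + 1)`.
sum-nodes : ∀ n (φ : ℕ → ℕ) → sum (map (φ ∘ slack) (nodes n)) ≡ raneySum n 1 φ
sum-nodes zero    φ = +-identityʳ (φ 0)
sum-nodes (suc n) φ = begin
  sum (map (φ ∘ slack) (concatMap children (nodes n)))             ≡⟨ sum-map-concatMap (φ ∘ slack) children (nodes n) ⟩
  sum (map (λ s → sum (map (φ ∘ slack) (children s))) (nodes n))   ≡⟨ sum-map-cong (sum-children φ) (nodes n) ⟩
  sum (map (grown ∘ slack) (nodes n))                              ≡⟨ sum-nodes n grown ⟩
  raneySum n 1 grown                                               ≡⟨ raneySum-grow n φ ⟩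
  raneySum (suc n) 1 φ                                             ∎
  where
  open ≡-Reasoning
  grown : ℕ → ℕ
  grown d = Σ≤ (Σ≤ (Σ≤ φ)) d + Σ≤ (Σ≤ (φ ∘ suc)) d

length≡sum : {A : Set} (xs : List A) → length xs ≡ sum (map (λ _ → 1) xs)
length≡sum []       = refl
length≡sum (x ∷ xs) = cong suc (length≡sum xs)

length-tops : ∀ n → length (concatMap tops (nodes n)) ≡ raney (suc n) 1
length-tops n = begin
  length (concatMap tops (nodes n))                           ≡⟨ length≡sum (concatMap tops (nodes n)) ⟩
  sum (map (λ _ → 1) (concatMap tops (nodes n)))              ≡⟨ sum-map-concatMap (λ _ → 1) tops (nodes n) ⟩
  sum (map (λ s → sum (map (λ _ → 1) (tops s))) (nodes n))    ≡⟨ sum-map-cong (λ s → sum-triangle {g = topsAt s} (λ _ → 1) (slack s)) (nodes n) ⟩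
  sum (map (Σ≤ (Σ≤ (λ _ → 1)) ∘ slack) (nodes n))             ≡⟨ sum-nodes n (Σ≤ (Σ≤ (λ _ → 1))) ⟩
  raneySum n 1 (Σ≤ (Σ≤ (λ _ → 1)))                            ≡⟨ raneySum-leaf n ⟩
  raney (suc n) 1                                             ∎
  where open ≡-Reasoning

-- The longest weakly increasing prefix now ends at `M`, since any next entry comes from `t` and is
-- smaller. Its length `suc p` exceeds the bound `suc M` by `c`.
canonical-once : ∀ {n t b D M p c} → Canonical n (node t b D) → b ≤ M → M + c ≡ p → p ≤ b + D →
  Canonical (suc n) (node (ins p M t) (suc M) c)
canonical-once {t = t} {M = M} {c = c} K b≤M refl p≤w = record
  { avoiding   = avoiding-ins (avoiding K) (<⇒≤ ∘ t<M) (m≤m+n M c) p≤len wi (λ s → M∉t (⊆-∈ (here refl) s))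
  ; dist≡      = trans (dist-ins-∉ {p} M∉t) (cong suc (dist≡ K))
  ; below      = ins-all p M t ≤-refl (m<n⇒m<1+n ∘ t<M)
  ; least      = λ h → h (∈-ins p M t)
  ; room       = subst (suc p ≤_) (sym (length-ins p M t)) (s≤s p≤len)
  ; increasing = subst WeaklyIncreasing (sym (take-suc-ins p M t))
      (weaklyIncreasing-snoc (take p t) (λ x∈ → <⇒≤ (t<M (⊆-∈ x∈ (take-⊆ p t)))) wi)
  ; maximal    = λ {i} i≤ wi′ → ≮⇒≥ λ p<i →
      let y , s , y∈ = follower p M t p<i (subst (i ≤_) (length-ins p M t) i≤) p≤len
      in <⇒≱ (t<M (⊆-∈ y∈ (take-⊆ (suc p) t))) (wi′ s)
  }
  where
  p : ℕ
  p = M + c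
  t<M : ∀ {x} → x ∈ t → x < M
  t<M x∈ = <-≤-trans (below K x∈) b≤M
  M∉t : M ∉ t
  M∉t M∈ = <-irrefl refl (t<M M∈)
  p≤len : p ≤ length t
  p≤len = ≤-trans p≤w (room K)
  wi : WeaklyIncreasing (take p t)
  wi s = increasing K (⊆-trans s (take⁺ p≤w))

-- The later copy is inserted first, so that `p + j` counts entries of `t` only; `avoiding-ins` then
-- applies twice.
canonical-twice : ∀ {n t b D M p c} → Canonical n (node t b D) → b ≤ M → M + c ≡ p → ∀ j → p + j ≤ b + D →
  Canonical (suc n) (node (ins p M (ins (p + j) M t)) (suc M) (nextSlack j c))
canonical-twice {t = t} {M = M} {c = c} K b≤M refl j q≤w = record
  { avoiding   = avoiding-ins
      (avoiding-ins (avoiding K) (<⇒≤ ∘ t<M) (≤-trans (m≤m+n M c) p≤q) q≤len wi (λ s → M∉t (⊆-∈ (here refl) s)))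
      u≤M (m≤m+n M c) p≤lenᵤ wiᵤ (M∉t ∘ twice-ins⇒∈ {q})
  ; dist≡      = trans (dist-ins-∈ {p} (∈-ins q M t)) (trans (dist-ins-∉ {q} M∉t) (cong suc (dist≡ K)))
  ; below      = ins-all p M u ≤-refl (s≤s ∘ u≤M)
  ; least      = λ h → h (∈-ins p M u)
  ; room       = room′ j refl
  ; increasing = increasing′ j refl
  ; maximal    = λ {i} i≤ wi′ → maximal′ j refl (subst (i ≤_) len i≤) wi′
  }
  where
  p q : ℕ
  p = M + c
  q = p + j
  u : List ℕ
  u = ins q M t
  p≤q : p ≤ q
  p≤q = m≤m+n p j
  t<M : ∀ {x} → x ∈ t → x < M
  t<M x∈ = <-≤-trans (below K x∈) b≤M
  M∉t : M ∉ t
  M∉t M∈ = <-irrefl refl (t<M M∈)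
  u≤M : ∀ {x} → x ∈ u → x ≤ M
  u≤M = ins-all q M t ≤-refl (<⇒≤ ∘ t<M)
  q≤len : q ≤ length t
  q≤len = ≤-trans q≤w (room K)
  p≤len : p ≤ length t
  p≤len = ≤-trans p≤q q≤len
  p≤lenᵤ : p ≤ length u
  p≤lenᵤ = subst (p ≤_) (sym (length-ins q M t)) (m≤n⇒m≤1+n p≤len)
  len : length (ins p M u) ≡ 2 + length t
  len = trans (length-ins p M u) (cong suc (length-ins q M t))
  wi : WeaklyIncreasing (take q t)
  wi s = increasing K (⊆-trans s (take⁺ q≤w))
  take-u : take p u ≡ take p t
  take-u = take-ins M t p≤q p≤len
  wiₚ : WeaklyIncreasing (take p t)
  wiₚ s = wi (⊆-trans s (take⁺ p≤q))
  wiᵤ : WeaklyIncreasing (take p u)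
  wiᵤ = subst WeaklyIncreasing (sym take-u) wiₚ
  take≤M : ∀ {x} → x ∈ take p t → x ≤ M
  take≤M x∈ = <⇒≤ (t<M (⊆-∈ x∈ (take-⊆ p t)))
  wi-M : WeaklyIncreasing (take p t ++ M ∷ [])
  wi-M = weaklyIncreasing-snoc (take p t) take≤M wiₚ
  -- Splitting on `j′` lets `nextSlack` reduce, while `q` and `u` keep referring to `j`.
  room′ : ∀ j′ → j′ ≡ j → suc M + nextSlack j′ c ≤ length (ins p M u)
  room′ zero    _ = subst₂ _≤_ (cong suc (sym (+-suc M c))) (sym len) (s≤s (s≤s p≤len))
  room′ (suc _) _ = subst (suc p ≤_) (sym len) (s≤s (m≤n⇒m≤1+n p≤len))
  increasing′ : ∀ j′ → j′ ≡ j → WeaklyIncreasing (take (suc M + nextSlack j′ c) (ins p M u))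
  increasing′ zero refl = subst WeaklyIncreasing (sym eq)
    (weaklyIncreasing-snoc (take p t ++ M ∷ []) (λ x∈ → snoc≤M (∈-++⁻ (take p t) x∈)) wi-M)
    where
    snoc≤M : ∀ {x} → x ∈ take p t ⊎ x ∈ M ∷ [] → x ≤ M
    snoc≤M (inj₁ x∈)          = take≤M x∈
    snoc≤M (inj₂ (here refl)) = ≤-refl
    eq : take (suc M + suc c) (ins p M u) ≡ (take p t ++ M ∷ []) ++ M ∷ []
    eq = trans (cong₂ (λ i r → take i (ins p M (ins r M t))) (cong suc (+-suc M c)) (+-identityʳ p)) (take-2+-ins-ins p M t)
  increasing′ (suc _) _ = subst WeaklyIncreasing
    (sym (trans (take-suc-ins p M u) (cong (_++ M ∷ []) take-u))) wi-M
  maximal′ : ∀ j′ → j′ ≡ j → ∀ {i} → i ≤ 2 + length t → WeaklyIncreasing (take i (ins p M u)) → i ≤ suc M + nextSlack j′ c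
  maximal′ zero refl {i} i≤ wi′ = ≮⇒≥ λ lt →
    let y , s , y∈ = follower₂ p M t (subst (_< i) (cong suc (+-suc M c)) lt) i≤ p≤len
    in <⇒≱ (t<M y∈) (wi′ (subst (λ r → M ∷ y ∷ [] ⊆ take i (ins p M (ins r M t))) (sym (+-identityʳ p)) s))
  -- The second copy lies behind position `p`, so the entry following the first copy still belongs
  -- to `t`.
  maximal′ (suc j′) refl {i} i≤ wi′ = ≮⇒≥ λ p<i →
    let y , s , y∈ = follower p M u p<i (subst (i ≤_) (cong suc (sym (length-ins q M t))) i≤) p≤lenᵤ
        p<q = subst (p <_) (sym (+-suc p j′)) (s≤s (m≤m+n p j′))
        y∈t = ⊆-∈ (subst (y ∈_) (take-ins M t p<q (≤-trans p<q q≤len)) y∈) (take-⊆ (suc p) t)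
    in <⇒≱ (t<M y∈t) (wi′ s)

top+slack : ∀ {a b c} → c ≤ a → b + (a ∸ c) + c ≡ b + a
top+slack {a} {b} {c} c≤a = trans (+-assoc b (a ∸ c) c) (cong (b +_) (m∸n+n≡m c≤a))

second≤ : ∀ {a b D j} → a ≤ D → j ≤ D ∸ a → b + a + j ≤ b + D
second≤ {a} {b} {D} {j} a≤D j≤ = begin
  b + a + j       ≡⟨ +-assoc b a j ⟩
  b + (a + j)     ≤⟨ +-monoʳ-≤ b (+-monoʳ-≤ a j≤) ⟩
  b + (a + (D ∸ a)) ≡⟨ cong (b +_) (m+[n∸m]≡n a≤D) ⟩
  b + D           ∎
  where open ≤-Reasoning

canonical-children : ∀ {n s z} → Canonical n s → z ∈ children s → Canonical (suc n) z
canonical-children {s = s@(node t b D)} K z∈ with ∈-triangle⁻ {g = childrenAt s} {D = D} z∈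
... | a , c , a≤D , c≤a , here refl = canonical-once K (m≤m+n b (a ∸ c)) (top+slack c≤a) (+-monoʳ-≤ b a≤D)
... | a , c , a≤D , c≤a , there z∈′ with ∈-map⁻ _ z∈′
... | j , j∈ , refl = canonical-twice K (m≤m+n b (a ∸ c)) (top+slack c≤a) j (second≤ a≤D (≤-pred (∈-upTo⁻ j∈)))

canonical : ∀ n {s} → s ∈ nodes n → Canonical n s
canonical zero (here refl) = record
  { avoiding   = record { bounded = tt ; no102 = λ () ; no000 = λ () }
  ; dist≡      = refl
  ; below      = λ ()
  ; least      = λ _ → z≤n
  ; room       = z≤n
  ; increasing = λ ()
  ; maximal    = λ i≤ _ → i≤
  }
canonical (suc n) z∈ with find (∈-concatMap⁻ children {xs = nodes n} z∈)
... | s , s∈ , z∈′ = canonical-children (canonical n s∈) z∈′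

-- The generating tree enumerates without repetition

-- What remains of an extension of `t` after its first copy of `M` is taken out.
data Layer (p M : ℕ) (t : List ℕ) : List ℕ → Set where
  once  : Layer p M t t
  twice : ∀ j → p + j ≤ length t → Layer p M t (ins (p + j) M t)

module _ {p M : ℕ} {t : List ℕ} (t<M : ∀ {x} → x ∈ t → x < M) where

  layer-≤ : ∀ {u} → Layer p M t u → ∀ {x} → x ∈ u → x ≤ M
  layer-≤ once        = <⇒≤ ∘ t<M
  layer-≤ (twice j _) = ins-all (p + j) M t ≤-refl (<⇒≤ ∘ t<M)

  layer-∉ : ∀ {u} → p ≤ length t → Layer p M t u → M ∉ take p u
  layer-∉ p≤ once        M∈ = <-irrefl refl (t<M (⊆-∈ M∈ (take-⊆ p t)))
  layer-∉ p≤ (twice j _) M∈ = layer-∉ p≤ once (subst (M ∈_) (take-ins M t (m≤m+n p j) p≤) M∈)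

layer-length : ∀ {p M t u} → p ≤ length t → Layer p M t u → p ≤ length u
layer-length p≤ once                    = p≤
layer-length {p} {M} {t} p≤ (twice j _) = subst (p ≤_) (sym (length-ins (p + j) M t)) (m≤n⇒m≤1+n p≤)

layer-injective : ∀ {p M t t′ u u′} → (∀ {x} → x ∈ t → x < M) → (∀ {x} → x ∈ t′ → x < M) →
  Layer p M t u → Layer p M t′ u′ → u ≡ u′ → t ≡ t′
layer-injective t<M t′<M once once eq = eq
layer-injective {p} {M} t<M t′<M once (twice j _) eq =
  contradiction (t<M (subst (M ∈_) (sym eq) (∈-ins (p + j) M _))) (<-irrefl refl)
layer-injective {p} {M} t<M t′<M (twice i _) once eq =
  contradiction (t′<M (subst (M ∈_) eq (∈-ins (p + i) M _))) (<-irrefl refl)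
layer-injective {p} {M} {t} {t′} t<M t′<M (twice i i≤) (twice j j≤) eq =
  proj₂ (ins-injective (p + i) (p + j) t t′ i≤ j≤
    (λ M∈ → <-irrefl refl (t<M (⊆-∈ M∈ (take-⊆ (p + i) t))))
    (λ M∈ → <-irrefl refl (t′<M (⊆-∈ M∈ (take-⊆ (p + j) t′)))) eq)

record Layered (s : Node) (a c : ℕ) (e : List ℕ) : Set where
  constructor layered
  field
    a≤     : a ≤ slack s
    {core} : List ℕ
    layer  : Layer (bound s + a) (bound s + (a ∸ c)) (seq s) core
    shape  : e ≡ ins (bound s + a) (bound s + (a ∸ c)) core

-- An extension determines its data: `M` is its maximum, `p` the index of the first `M`, and
-- deleting every `M` leaves the parent.
layered-injective : ∀ {m n s s′ a a′ c c′ e} → Canonical m s → Canonical n s′ → Layered s a c e → Layered s′ a′ c′ e →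
  seq s ≡ seq s′ × bound s + a ≡ bound s′ + a′ × bound s + (a ∸ c) ≡ bound s′ + (a′ ∸ c′)
layered-injective {s = s} {s′} {a} {a′} {c} {c′} K K′ (layered a≤ {u} l refl) (layered a′≤ {u′} l′ eq) =
  conclude (ins-injective {M} p p′ u u′ (layer-length p≤ l) (layer-length p′≤ l′)
    (layer-∉ t<M p≤ l) (subst (_∉ take p′ u′) (sym M≡M′) (layer-∉ t′<M′ p′≤ l′))
    (trans eq (cong (λ N → ins p′ N u′) (sym M≡M′))))
  where
  p p′ M M′ : ℕ
  p  = bound s + a
  p′ = bound s′ + a′
  M  = bound s + (a ∸ c)
  M′ = bound s′ + (a′ ∸ c′)
  p≤ : p ≤ length (seq s)
  p≤ = ≤-trans (+-monoʳ-≤ (bound s) a≤) (room K)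
  p′≤ : p′ ≤ length (seq s′)
  p′≤ = ≤-trans (+-monoʳ-≤ (bound s′) a′≤) (room K′)
  t<M : ∀ {x} → x ∈ seq s → x < M
  t<M x∈ = <-≤-trans (below K x∈) (m≤m+n (bound s) (a ∸ c))
  t′<M′ : ∀ {x} → x ∈ seq s′ → x < M′
  t′<M′ x∈ = <-≤-trans (below K′ x∈) (m≤m+n (bound s′) (a′ ∸ c′))
  M≡M′ : M ≡ M′
  M≡M′ = trans (sym (maxE-ins p u (layer-≤ t<M l))) (trans (cong maxE eq) (maxE-ins p′ u′ (layer-≤ t′<M′ l′)))
  conclude : p ≡ p′ × u ≡ u′ → seq s ≡ seq s′ × p ≡ p′ × M ≡ M′
  conclude (p≡p′ , u≡u′) = layer-injective t<M (λ {x} x∈ → subst (x <_) (sym M≡M′) (t′<M′ x∈)) l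
    (subst₂ (λ q N → Layer q N (seq s′) u′) (sym p≡p′) (sym M≡M′) l′) u≡u′ , p≡p′ , M≡M′

layered-place : ∀ {n s a a′ c c′ e} → Canonical n s → c ≤ a → c′ ≤ a′ → Layered s a c e → Layered s a′ c′ e → a ≡ a′ × c ≡ c′
layered-place {s = s} {a} {a′} {c} {c′} K c≤a c′≤a′ l l′ with layered-injective K K l l′
... | _ , p≡p′ , M≡M′ with +-cancelˡ-≡ (bound s) a a′ p≡p′
... | refl = refl , ∸-cancelˡ-≡ c≤a c′≤a′ (+-cancelˡ-≡ (bound s) (a ∸ c) (a ∸ c′) M≡M′)

childrenAt-layered : ∀ {n s a c z} → Canonical n s → a ≤ slack s → z ∈ childrenAt s a c → Layered s a c (seq z)
childrenAt-layered K a≤ (here refl) = layered a≤ once refl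
childrenAt-layered {s = s} {a} K a≤ (there z∈) with ∈-map⁻ _ z∈
... | j , j∈ , refl = layered a≤ (twice j (≤-trans (second≤ {a} {bound s} a≤ (≤-pred (∈-upTo⁻ j∈))) (room K))) refl

topsAt-layered : ∀ {s a c e} → a ≤ slack s → e ∈ topsAt s a c → Layered s a c e
topsAt-layered a≤ (here refl) = layered a≤ once refl

childrenAt-distinct : ∀ {n s a c} → Canonical n s → a ≤ slack s → Distinct seq (childrenAt s a c)
childrenAt-distinct {s = s@(node t b D)} {a} {c} K a≤ = All.tabulate single≢double ∷
  AllPairs.map⁺ (AllPairs.applyUpTo⁺₁ id (suc (D ∸ a)) λ i<j j≤ eq → <⇒≢ i<j (double-injective (<-≤-trans i<j (≤-pred j≤)) j≤ eq))
  where
  p M : ℕ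
  p = b + a
  M = b + (a ∸ c)
  q≤ : ∀ {j} → j ≤ D ∸ a → p + j ≤ length t
  q≤ j≤ = ≤-trans (second≤ {a} {b} a≤ j≤) (room K)
  M∉ : ∀ q → M ∉ take q t
  M∉ q M∈ = <⇒≱ (below K (⊆-∈ M∈ (take-⊆ q t))) (m≤m+n b (a ∸ c))
  double : ℕ → Node
  double j = node (ins p M (ins (p + j) M t)) (suc M) (nextSlack j c)
  single≢double : ∀ {z} → z ∈ map double (upTo (suc (D ∸ a))) → ins p M t ≢ seq z
  single≢double z∈ eq with ∈-map⁻ double z∈
  -- One copy and two copies of `M` give different lengths.
  ... | j , _ , refl = 1+n≢n (begin
    suc (suc (length t))                  ≡⟨ cong suc (length-ins (p + j) M t) ⟨
    suc (length (ins (p + j) M t))        ≡⟨ length-ins p M (ins (p + j) M t) ⟨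
    length (ins p M (ins (p + j) M t))    ≡⟨ cong length eq ⟨
    length (ins p M t)                    ≡⟨ length-ins p M t ⟩
    suc (length t)                        ∎)
    where open ≡-Reasoning
  t<M : ∀ {x} → x ∈ t → x < M
  t<M x∈ = <-≤-trans (below K x∈) (m≤m+n b (a ∸ c))
  p≤ : p ≤ length t
  p≤ = ≤-trans (m≤m+n p 0) (q≤ z≤n)
  double-injective : ∀ {i j} → i < D ∸ a → j < suc (D ∸ a) → ins p M (ins (p + i) M t) ≡ ins p M (ins (p + j) M t) → i ≡ j
  double-injective {i} {j} i< j< eq = +-cancelˡ-≡ p i j (proj₁ (ins-injective (p + i) (p + j) t t
    (q≤ (<⇒≤ i<)) (q≤ (≤-pred j<)) (M∉ _) (M∉ _) (proj₂ (ins-injective p p _ _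
      (layer-length p≤ (twice i (q≤ (<⇒≤ i<)))) (layer-length p≤ (twice j (q≤ (≤-pred j<))))
      (layer-∉ t<M p≤ (twice i (q≤ (<⇒≤ i<)))) (layer-∉ t<M p≤ (twice j (q≤ (≤-pred j<)))) eq))))

children-distinct : ∀ {n s} → Canonical n s → Distinct seq (children s)
children-distinct {s = s} K = triangle-distinct {g = childrenAt s} seq (slack s)
  (λ a≤ c≤ → childrenAt-distinct K a≤)
  λ a≤ c≤ a′≤ c′≤ z∈ w∈ eq → layered-place K c≤ c′≤
    (childrenAt-layered K a≤ z∈) (subst (Layered s _ _) (sym eq) (childrenAt-layered K a′≤ w∈))

nodes-distinct : ∀ n → Distinct seq (nodes n)
nodes-distinct zero    = [] ∷ []
nodes-distinct (suc n) = concatMap-distinct seq seq (nodes-distinct n) (children-distinct ∘ canonical n) separated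
  where
  separated : ∀ {s s′ z w} → s ∈ nodes n → s′ ∈ nodes n → z ∈ children s → w ∈ children s′ → seq z ≡ seq w → seq s ≡ seq s′
  separated {s} {s′} s∈ s′∈ z∈ w∈ eq with ∈-triangle⁻ {g = childrenAt s} {D = slack s} z∈ | ∈-triangle⁻ {g = childrenAt s′} {D = slack s′} w∈
  ... | a , c , a≤ , _ , z∈′ | a′ , c′ , a′≤ , _ , w∈′ = proj₁ (layered-injective (canonical n s∈) (canonical n s′∈)
    (childrenAt-layered (canonical n s∈) a≤ z∈′) (subst (Layered s′ a′ c′) (sym eq) (childrenAt-layered (canonical n s′∈) a′≤ w∈′)))

tops-unique : ∀ n → Unique (concatMap tops (nodes n))
tops-unique n = concatMap-distinct seq id (nodes-distinct n)
  (λ {s} s∈ → triangle-distinct {g = topsAt s} id (slack s) (λ _ _ → [] ∷ [])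
    λ {a} {c} {a′} {c′} a≤ c≤ a′≤ c′≤ e∈ f∈ eq → layered-place (canonical n s∈) c≤ c′≤
      (topsAt-layered {c = c} a≤ e∈) (subst (Layered s a′ c′) (sym eq) (topsAt-layered {c = c′} a′≤ f∈)))
  separated
  where
  separated : ∀ {s s′ e f} → s ∈ nodes n → s′ ∈ nodes n → e ∈ tops s → f ∈ tops s′ → e ≡ f → seq s ≡ seq s′
  separated {s} {s′} s∈ s′∈ e∈ f∈ eq with ∈-triangle⁻ {g = topsAt s} {D = slack s} e∈ | ∈-triangle⁻ {g = topsAt s′} {D = slack s′} f∈
  ... | a , c , a≤ , _ , e∈′ | a′ , c′ , a′≤ , _ , f∈′ = proj₁ (layered-injective (canonical n s∈) (canonical n s′∈)
    (topsAt-layered {c = c} a≤ e∈′) (subst (Layered s′ a′ c′) (sym eq) (topsAt-layered {c = c′} a′≤ f∈′)))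

-- Removing the largest value

record Peel (e : List ℕ) : Set where
  constructor peel
  field
    {p M}  : ℕ
    {u}    : List ℕ
    e≡     : e ≡ ins p M u
    u≤M    : ∀ {x} → x ∈ u → x ≤ M
    p≤     : p ≤ length u
    M∉     : M ∉ take p u

peelMax : ∀ x l → Peel (x ∷ l)
peelMax x l with ins-split (maxE-∈ x l)
... | p , u , eq , p≤ , M∉ = peel eq (λ y∈ → ≤-maxE (x ∷ l) (subst (_ ∈_) (sym eq) (⊆-∈ y∈ (ins-⊇ p _ u)))) p≤ M∉

record Position (s : Node) (p M : ℕ) : Set where
  constructor position
  field
    a c  : ℕ
    a≤   : a ≤ slack s
    c≤a  : c ≤ a
    p≡   : p ≡ bound s + a
    M≡   : M ≡ bound s + (a ∸ c)

locate : ∀ {s p M} → bound s ≤ M → M ≤ p → p ≤ bound s + slack s → Position s p M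
locate {s} b≤M M≤p p≤w with m≤n⇒∃[o]m+o≡n b≤M
... | m , refl with m≤n⇒∃[o]m+o≡n M≤p
... | c , refl = position (m + c) c
  (+-cancelˡ-≤ (bound s) _ _ (subst (_≤ bound s + slack s) (+-assoc (bound s) m c) p≤w))
  (m≤n+m c m) (+-assoc (bound s) m c) (cong (bound s +_) (sym (m+n∸n≡m m c)))

-- `least` supplies the lower bound on `M` and `maximal` the upper bound on `p`; together they make
-- the placement one of those in the tree.
locate-in : ∀ {n s p M} → Canonical n s → (∀ {x} → x ∈ seq s → x < M) → M ≤ p → ∀ {q} → p ≤ q → q ≤ length (seq s) →
  WeaklyIncreasing (take q (seq s)) → Position s p M
locate-in K t<M M≤p p≤q q≤ wi = locate (least K t<M) M≤p (≤-trans p≤q (maximal K q≤ wi))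

∉⇒< : ∀ {M : ℕ} {u} → (∀ {x} → x ∈ u → x ≤ M) → M ∉ u → ∀ {x} → x ∈ u → x < M
∉⇒< u≤M M∉u x∈ = ≤∧≢⇒< (u≤M x∈) λ { refl → M∉u x∈ }

-- Induction on `n`: deleting all copies of the largest value preserves avoidance and lowers `dist`
-- by one, and the deleted copies stood at places the tree uses.
complete : ∀ n {e} → Avoiding e → dist e ≡ n → ∃ λ s → s ∈ nodes n × seq s ≡ e

complete-top : ∀ n {p M u} → Avoiding u → dist u ≡ n → (∀ {x} → x ∈ u → x < M) → M ≤ p → p ≤ length u → WeaklyIncreasing (take p u) →
  ∃ λ s → s ∈ nodes n × seq s ≡ u × Position s p M
complete-top n av d u<M M≤p p≤ wi with complete n av d
... | s , s∈ , refl = s , s∈ , refl , locate-in (canonical n s∈) u<M M≤p ≤-refl p≤ wi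

complete zero {[]} av d = node [] 0 0 , here refl , refl
complete (suc n) {x ∷ l} av d with peelMax x l
... | peel {p} {M} {u} eq u≤M p≤ M∉ with avoiding-ins⁻ (subst Avoiding eq av) u≤M p≤ M∉ | M ∈? u
...   | avᵤ , M≤p , wi | no M∉u with complete-top n avᵤ
        (suc-injective (trans (sym (dist-ins-∉ {p} M∉u)) (trans (cong dist (sym eq)) d))) (∉⇒< u≤M M∉u) M≤p p≤ wi
...     | s , s∈ , refl , position a c a≤ c≤ refl refl =
          node (ins p M u) (suc M) c , ∈-concatMap⁺ children (lose s∈ (∈-triangle⁺ {g = childrenAt s} a≤ c≤ (here refl))) , sym eq
complete (suc n) {x ∷ l} av d | peel {p} {M} {u} eq u≤M p≤ M∉ | avᵤ , M≤p , wi | yes M∈u with ins-split M∈u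
...   | q , t , refl , q≤ , M∉′ with avoiding-ins⁻ avᵤ (λ x∈ → u≤M (⊆-∈ x∈ (ins-⊇ q M t))) q≤ M∉′ | M ∈? t
-- A third copy of `M` would give a 000.
...     | avₜ , _ , wi′ | yes M∈t = contradiction
          (replicate-⊆-ins 2 p M u (replicate-⊆-ins 1 q M t (from∈ M∈t))) (no000 (subst Avoiding eq av))
...     | avₜ , _ , wi′ | no M∉t with complete n avₜ
          (suc-injective (trans (sym (trans (dist-ins-∈ {p} M∈u) (dist-ins-∉ {q} M∉t))) (trans (cong dist (sym eq)) d)))
-- The first copy was taken out first, so the second cannot lie in the prefix of length `p`.
...       | s , s∈ , refl with ≮⇒≥ (M∉ ∘ ∈-take-ins {p} {q} M t)
...         | p≤q with locate-in (canonical n s∈) (∉⇒< (λ x∈ → u≤M (⊆-∈ x∈ (ins-⊇ q M t))) M∉t) M≤p p≤q q≤ wi′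
...           | position a c a≤ c≤ refl refl with m≤n⇒∃[o]m+o≡n p≤q
...             | j , refl = _ , ∈-concatMap⁺ children (lose s∈ (∈-triangle⁺ {g = childrenAt s} a≤ c≤ (there (∈-map⁺ _ (∈-upTo⁺ (s≤s j≤)))))) , sym eq
  where
  j≤ : j ≤ slack s ∸ a
  -- The prefix before the second copy is weakly increasing, so `maximal` bounds `a + j` by the
  -- slack.
  j≤ = m+n≤o⇒m≤o∸n j (subst (_≤ slack s) (+-comm a j) (+-cancelˡ-≤ (bound s) _ _ (subst (_≤ bound s + slack s) (+-assoc (bound s) a j) (maximal (canonical n s∈) q≤ wi′))))

tops⇒good : ∀ n {e} → e ∈ concatMap tops (nodes n) → Good (suc n) e
tops⇒good n e∈ with find (∈-concatMap⁻ tops {xs = nodes n} e∈)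
... | s , s∈ , e∈′ with ∈-triangle⁻ {g = topsAt s} {D = slack s} e∈′
... | a , c , a≤ , c≤ , here refl = subst (λ d → Good d (ins p M (seq s))) (dist≡ K′)
  (avoiding⇒good (avoiding K′) (trans (maxMult-ins p (seq s) (<⇒≤ ∘ t<M)) (cong suc (∉⇒count≡0 λ M∈ → <-irrefl refl (t<M M∈)))))
  where
  p M : ℕ
  p = bound s + a
  M = bound s + (a ∸ c)
  K : Canonical n s
  K = canonical n s∈
  K′ : Canonical (suc n) (node (ins p M (seq s)) (suc M) c)
  K′ = canonical-once K (m≤m+n (bound s) (a ∸ c)) (top+slack c≤) (+-monoʳ-≤ (bound s) a≤)
  t<M : ∀ {x} → x ∈ seq s → x < M
  t<M x∈ = <-≤-trans (below K x∈) (m≤m+n (bound s) (a ∸ c))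

-- Multiplicity one means that deleting the first maximum already deletes every copy, so the
-- remainder lies on level `n`.
good⇒tops : ∀ n {e} → Good (suc n) e → e ∈ concatMap tops (nodes n)
good⇒tops n {[]} (_ , _ , _ , () , _)
good⇒tops n {x ∷ l} good@(_ , _ , _ , d , mult) with peelMax x l
... | peel {p} {M} {u} eq u≤M p≤ M∉ with avoiding-ins⁻ (subst Avoiding eq (good⇒avoiding good)) u≤M p≤ M∉
... | avᵤ , M≤p , wi with complete-top n avᵤ
      (suc-injective (trans (sym (dist-ins-∉ {p} M∉u)) (trans (cong dist (sym eq)) d))) (∉⇒< u≤M M∉u) M≤p p≤ wi
  where
  M∉u : M ∉ u
  M∉u = count≡0⇒∉ u (suc-injective (trans (sym (maxMult-ins p u u≤M)) (trans (cong maxMult (sym eq)) mult)))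
... | s , s∈ , refl , position a c a≤ c≤ refl refl = subst (_∈ concatMap tops (nodes n)) (sym eq)
      (∈-concatMap⁺ tops (lose s∈ (∈-triangle⁺ {g = topsAt s} a≤ c≤ (here refl))))

theorem3p4 : (m : ℕ) → 1 ≤ m →
    Σ (List (List ℕ)) λ L →
    Unique L
    × ((e : List ℕ) → (e ∈ L → Good m e) × (Good m e → e ∈ L))
    × length L ≡ ((4 * m) C m) / suc (3 * m)
theorem3p4 (suc n) _ = concatMap tops (nodes n) , tops-unique n , (λ e → tops⇒good n , good⇒tops n) ,
  trans (length-tops n) (raney-fussCatalan n)
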